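{- There exists an infinite $(7/3)^+$-power-free word $\mathbf{w}$ over $\{0,1\}$ that contains arbitrarily large squares beginning at every position; that is, for every position $i$ of $\mathbf{w}$ and every $N$, there is a square of length at least $N$ occurring in $\mathbf{w}$ beginning at position $i$.
   Context: A finite word $w$ is an $\alpha$-power ($\alpha$ rational) if $w = x^n x'$ with $x$ nonempty, $x'$ a prefix of $x$, and $\alpha = n + |x'|/|x|$. An $\alpha^+$-power is a word that is a $\beta$-power for some $\beta>\alpha$. A word is $\alpha^+$-power-free if none of its factors (contiguous subwords) is an $\alpha^+$-power. A square is a word $xx$ with $x$ nonempty. -}

module Defs where

open import Data.Integer.Base using (+_)
open import Data.List.Base using (List; _++_; length; concat; replicate; applyUpTo)
open import Data.List.NonEmpty as List⁺ using (List⁺; toList)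
open import Data.List.Relation.Binary.Prefix.Heterogeneous using (Prefix)
open import Data.Nat.Base as ℕ using (ℕ)
open import Data.Product.Base using (∃-syntax; _×_)
open import Data.Rational.Base using (ℚ; _/_; _+_; _<_)
open import Level using (Level)
open import Relation.Binary.PropositionalEquality.Core using (_≡_)
open import Relation.Nullary.Negation.Core using (¬_)

private
  variable
    a : Level
    A : Set a

record IsPower {A : Set a} (α : ℚ) (w : List A) : Set a where
  field
    x         : List⁺ A
    n         : ℕ
    x′        : List A
    x′-prefix : Prefix _≡_ x′ (toList x)
    w≡xⁿx′    : w ≡ concat (replicate n (toList x)) ++ x′
    exponent  : α ≡ + n / 1 + + length x′ / List⁺.length x

IsPower⁺ : {A : Set a} → ℚ → List A → Set a
IsPower⁺ α w = ∃[ β ] α < β × IsPower β w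

IsSquare : {A : Set a} → List A → Set a
IsSquare {A = A} w = ∃[ x ] w ≡ toList {A = A} x ++ toList x

InfiniteWord : Set a → Set a
InfiniteWord A = ℕ → A

factor : InfiniteWord A → (i n : ℕ) → List A
factor w i n = applyUpTo (λ k → w (i ℕ.+ k)) n

OccursAt : {A : Set a} → InfiniteWord A → ℕ → List A → Set a
OccursAt w i u = factor w i (length u) ≡ u

IsFactor : {A : Set a} → InfiniteWord A → List A → Set a
IsFactor w u = ∃[ i ] OccursAt w i u

Power⁺-Free : {A : Set a} → ℚ → InfiniteWord A → Set a
Power⁺-Free α w = ∀ u → IsFactor w u → ¬ IsPower⁺ α u

{-# OPTIONS --safe #-}
module Submission where

-- The word is the fixed point of a 39-uniform morphism whose image of 1 is the
-- complement of its image c of 0, so word (39 k + t) = c t xor word k.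
--
-- Squares: the prefix of length 31 has period 15 and 31 = 2 · 15 + 1, so applying the
-- morphism n times gives a prefix of length 31 · 39ⁿ and period 15 · 39ⁿ, in which a
-- square of period 15 · 39ⁿ begins at every position up to 39ⁿ.
--
-- Power-freeness: a factor of length ℓ and period p is a (7/3)⁺-power when
-- 4 p < 3 (ℓ − p).  For p ≤ 58 these factors are excluded by inspecting the second
-- iterates of all words of length 2.  For larger p the factor, shifted by p, would
-- match a whole block with another occurrence of it; no block occurs off the block
-- boundaries, so 39 divides p, and reading one letter per block yields a factor that
-- is again too long for its period p / 39.

open import Defs
open import Data.Bool.Base using (Bool; true; false; _∧_; _∨_; _xor_; T)
open import Data.Bool.ListAction using (all)
open import Data.Bool.Properties using (_≟_; T-∧; xor-assoc; xor-same)
open import Data.Fin.Base using (Fin; zero; suc)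
import Data.Integer.Base as ℤ
import Data.Integer.Properties as ℤ
open import Data.List.Base using (List; []; _∷_; _++_; applyUpTo; concat; concatMap; drop; length; replicate; upTo)
open import Data.List.Membership.Propositional.Properties using (∈-upTo⁺)
open import Data.List.NonEmpty as List⁺ using (List⁺; toList)
open import Data.List.Properties using (++-assoc; length-++; length-applyUpTo)
open import Data.List.Relation.Binary.Prefix.Heterogeneous using (Prefix; []; _∷_; _++ᵖ_)
import Data.List.Relation.Unary.All as All
open import Data.List.Relation.Unary.All.Properties using (all⁺)
open import Data.Nat.Base as ℕ using (ℕ; zero; suc; _+_; _*_; _∸_; _^_; _≤_; _<_; z≤n; s≤s; z<s; s<s; NonZero; >-nonZero; _≡ᵇ_)
open import Data.Nat.DivMod using (_%_; m≡m%n+[m/n]*n; m%n<n; m/n<m; m<n*o⇒m/o<n; m*n/n≡m; m/n*n≤m; +-distrib-/-∣ʳ; [m+kn]%n≡m%n; m<n⇒m%n≡m; m<n⇒m/n≡0; 0/n≡0)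
open import Data.Nat.Divisibility using (divides-refl)
open import Data.Nat.Induction using (<-rec)
open import Data.Nat.Properties hiding (_≟_)
open import Data.Nat.Tactic.RingSolver using (solve-∀)
open import Data.Product.Base using (Σ-syntax; ∃-syntax; _×_; _,_; proj₁; proj₂)
open import Data.Rational.Base as ℚ using (toℚᵘ)
import Data.Rational.Properties as ℚ
open import Data.Rational.Unnormalised.Base as ℚᵘ using (mkℚᵘ)
import Data.Rational.Unnormalised.Properties as ℚᵘ
open import Function.Base using (_∘_; case_of_)
open import Function.Bundles using (Equivalence)
open import Relation.Binary.PropositionalEquality using (_≡_; _≢_; refl; sym; trans; cong; cong₂; subst; subst₂; module ≡-Reasoning)
open import Relation.Nullary.Decidable.Core using (yes; no; toWitness)
open import Relation.Nullary.Negation.Core using (¬_)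

-- Agreement of sequences, powers and periods

Agree : {A : Set} → (ℕ → A) → (ℕ → A) → ℕ → Set
Agree f g m = ∀ t → t < m → f t ≡ g t

Differ : {A : Set} → (ℕ → A) → (ℕ → A) → ℕ → Set
Differ f g m = ∃[ t ] t < m × f t ≢ g t

applyUpTo-cong : ∀ {A : Set} {f g : ℕ → A} n → Agree f g n → applyUpTo f n ≡ applyUpTo g n
applyUpTo-cong zero    f≡g = refl
applyUpTo-cong (suc n) f≡g = cong₂ _∷_ (f≡g 0 z<s) (applyUpTo-cong n (λ t t<n → f≡g (suc t) (s<s t<n)))

applyUpTo-+ : ∀ {A : Set} (f : ℕ → A) m n → applyUpTo f (m + n) ≡ applyUpTo f m ++ applyUpTo (f ∘ (m +_)) n
applyUpTo-+ f zero    n = refl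
applyUpTo-+ f (suc m) n = cong (f 0 ∷_) (applyUpTo-+ (f ∘ suc) m n)

drop-applyUpTo : ∀ {A : Set} (f : ℕ → A) m n → drop m (applyUpTo f n) ≡ applyUpTo (f ∘ (m +_)) (n ∸ m)
drop-applyUpTo f zero    n       = refl
drop-applyUpTo f (suc m) zero    = refl
drop-applyUpTo f (suc m) (suc n) = drop-applyUpTo (f ∘ suc) m n

++-prefix : ∀ {A : Set} (xs : List A) {ys zs} → Prefix _≡_ ys zs → Prefix _≡_ (xs ++ ys) (xs ++ zs)
++-prefix []       pre = pre
++-prefix (x ∷ xs) pre = refl ∷ ++-prefix xs pre

-- Being a prefix of `xs ++ u` expresses that `length xs` is a period of `u`. In this form the
-- induction on `n` prepends `xs` to both sides and involves no index arithmetic.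
power-prefix : ∀ {A : Set} (xs : List A) n {xs′} → Prefix _≡_ xs′ xs →
               Prefix _≡_ (concat (replicate n xs) ++ xs′) (xs ++ concat (replicate n xs) ++ xs′)
power-prefix xs zero    {xs′} pre = pre ++ᵖ xs′
power-prefix xs (suc n) {xs′} pre =
  subst (λ u → Prefix _≡_ u (xs ++ u)) (sym (++-assoc xs (concat (replicate n xs)) xs′))
    (++-prefix xs (power-prefix xs n pre))

length-power : ∀ {A : Set} (xs : List A) n xs′ →
               length (concat (replicate n xs) ++ xs′) ≡ n * length xs + length xs′
length-power xs zero    xs′ = refl
length-power xs (suc n) xs′ = begin
  length ((xs ++ xsⁿ) ++ xs′)                   ≡⟨ cong length (++-assoc xs xsⁿ xs′) ⟩
  length (xs ++ xsⁿ ++ xs′)                     ≡⟨ length-++ xs ⟩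
  length xs + length (xsⁿ ++ xs′)               ≡⟨ cong (_+_ (length xs)) (length-power xs n xs′) ⟩
  length xs + (n * length xs + length xs′)      ≡⟨ +-assoc (length xs) _ _ ⟨
  length xs + n * length xs + length xs′        ∎
  where
  open ≡-Reasoning
  xsⁿ = concat (replicate n xs)

-- The comparison moves to unnormalised rationals, where the sum has the explicit denominator
-- `1 * p` and the inequality is a cross-multiplication.
exponent-long : ∀ n l p .{{_ : NonZero p}} → (ℤ.+ 7) ℚ./ 3 ℚ.< (ℤ.+ n) ℚ./ 1 ℚ.+ (ℤ.+ l) ℚ./ p →
                7 * p < 3 * (n * p + l)
exponent-long n l p@(suc p-1) 7/3< = subst₂ _<_ (cong (7 *_) (*-identityˡ p)) shape (ℤ.drop‿+<+ (subst₂ ℤ._<_ lhs rhs (ℚᵘ.drop-*<* un)))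
  where
  N = mkℚᵘ (ℤ.+ n) 0
  F = mkℚᵘ (ℤ.+ l) p-1
  un : mkℚᵘ (ℤ.+ 7) 2 ℚᵘ.< N ℚᵘ.+ F
  un = begin-strict
    mkℚᵘ (ℤ.+ 7) 2                                       ≃⟨ ℚ.toℚᵘ-fromℚᵘ (mkℚᵘ (ℤ.+ 7) 2) ⟨
    toℚᵘ ((ℤ.+ 7) ℚ./ 3)                                 <⟨ ℚ.toℚᵘ-mono-< 7/3< ⟩
    toℚᵘ ((ℤ.+ n) ℚ./ 1 ℚ.+ (ℤ.+ l) ℚ./ p)               ≃⟨ ℚ.toℚᵘ-homo-+ ((ℤ.+ n) ℚ./ 1) ((ℤ.+ l) ℚ./ p) ⟩
    toℚᵘ ((ℤ.+ n) ℚ./ 1) ℚᵘ.+ toℚᵘ ((ℤ.+ l) ℚ./ p)       ≃⟨ ℚᵘ.+-cong (ℚ.toℚᵘ-fromℚᵘ N) (ℚ.toℚᵘ-fromℚᵘ F) ⟩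
    N ℚᵘ.+ F                                             ∎
    where open ℚᵘ.≤-Reasoning
  lhs : ℤ.+ 7 ℤ.* ℤ.+ (1 * p) ≡ ℤ.+ (7 * (1 * p))
  lhs = sym (ℤ.pos-* 7 (1 * p))
  rhs : (ℤ.+ n ℤ.* ℤ.+ p ℤ.+ ℤ.+ l ℤ.* ℤ.+ 1) ℤ.* ℤ.+ 3 ≡ ℤ.+ ((n * p + l * 1) * 3)
  rhs = trans (cong (ℤ._* ℤ.+ 3) (cong₂ ℤ._+_ (sym (ℤ.pos-* n p)) (sym (ℤ.pos-* l 1)))) (sym (ℤ.pos-* (n * p + l * 1) 3))
  shape : (n * p + l * 1) * 3 ≡ 3 * (n * p + l)
  shape = trans (*-comm (n * p + l * 1) 3) (cong (λ u → 3 * (n * p + u)) (*-identityʳ l))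

-- The exponent is `length u` over `length xs`, so exceeding 7/3 becomes an inequality between
-- lengths.
power⁺-period : ∀ {A : Set} {u : List A} → IsPower⁺ ((ℤ.+ 7) ℚ./ 3) u →
                ∃[ xs ] 0 < length xs × 7 * length xs < 3 * length u × Prefix _≡_ u (xs ++ u)
power⁺-period {u = u} (β , 7/3<β , pow) = toList x , z<s ,
  subst (λ l → 7 * List⁺.length x < 3 * l) (sym (trans (cong length w≡xⁿx′) (length-power (toList x) n x′)))
    (exponent-long n (length x′) (List⁺.length x) (subst (ℚ._<_ ((ℤ.+ 7) ℚ./ 3)) exponent 7/3<β)) ,
  subst (λ v → Prefix _≡_ v (toList x ++ v)) (sym w≡xⁿx′) (power-prefix (toList x) n x′-prefix)
  where open IsPower pow

applyUpTo-prefix : ∀ {A : Set} (f g : ℕ → A) m n → Prefix _≡_ (applyUpTo f m) (applyUpTo g n) →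
                   ∀ t → t < m → f t ≡ g t
applyUpTo-prefix f g (suc m) (suc n) (eq ∷ pre) zero    _         = eq
applyUpTo-prefix f g (suc m) (suc n) (eq ∷ pre) (suc t) (s≤s t<m) = applyUpTo-prefix (f ∘ suc) (g ∘ suc) m n pre t t<m

prefix-shift : ∀ {A : Set} (xs : List A) (f g : ℕ → A) m n → Prefix _≡_ (applyUpTo f m) (xs ++ applyUpTo g n) →
               ∀ t → length xs + t < m → f (length xs + t) ≡ g t
prefix-shift []       f g m       n pre        t lt       = applyUpTo-prefix f g m n pre t lt
prefix-shift (x ∷ xs) f g (suc m) n (eq ∷ pre) t (s≤s lt) = prefix-shift xs (f ∘ suc) g m n pre t lt

square-at : ∀ {A : Set} (w : InfiniteWord A) i m → 0 < m → Agree (λ t → w (i + t)) (λ t → w (i + (m + t))) m →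
            ∃[ u ] IsSquare u × length u ≡ m + m × OccursAt w i u
square-at w i m@(suc _) _ per = u , (List⁺._∷_ _ _ , refl) , len , occurs
  where
  xs = factor w i m
  u  = xs ++ xs
  len : length u ≡ m + m
  len = trans (length-++ xs) (cong₂ _+_ (length-applyUpTo (λ t → w (i + t)) m) (length-applyUpTo (λ t → w (i + t)) m))
  occurs : OccursAt w i u
  occurs = trans (cong (factor w i) len)
    (trans (applyUpTo-+ (λ t → w (i + t)) m m) (cong (_++_ xs) (sym (applyUpTo-cong m per))))

-- Boolean tests for unequal windows

differ : ℕ → List Bool → List Bool → Bool
differ (suc m) (x ∷ xs) (y ∷ ys) = (x xor y) ∨ differ m xs ys
-- Exhausted lists count as agreeing, so a list that is too short never certifies a spurious
-- difference.
differ _       _        _        = false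

differ-sound : ∀ m {f g} a b → T (differ m (applyUpTo f a) (applyUpTo g b)) → Differ f g m
differ-sound (suc m) {f} {g} (suc a) (suc b) d with f 0 in f0 | g 0 in g0
... | true  | false = 0 , z<s , λ eq → case trans (sym f0) (trans eq g0) of λ ()
... | false | true  = 0 , z<s , λ eq → case trans (sym f0) (trans eq g0) of λ ()
... | true  | true  = let t , t<m , ne = differ-sound m a b d in suc t , s<s t<m , ne
... | false | false = let t , t<m , ne = differ-sound m a b d in suc t , s<s t<m , ne

differ-drop : ∀ m p {f g} a b → T (differ m (applyUpTo f a) (drop p (applyUpTo g b))) → Differ f (g ∘ (p +_)) m
differ-drop m p {f} {g} a b d =
  differ-sound m a (b ∸ p) (subst (λ ys → T (differ m (applyUpTo f a) ys)) (drop-applyUpTo g p b) d)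

-- Compares the windows of length m starting at i in both lists, for each i < k.
slide : ℕ → ℕ → List Bool → List Bool → Bool
slide zero    m xs ys = true
slide (suc k) m xs ys = differ m xs ys ∧ slide k m (drop 1 xs) (drop 1 ys)

slide-sound : ∀ k m {f g} a b → T (slide k m (applyUpTo f a) (applyUpTo g b)) →
              ∀ i → i < k → Differ (f ∘ (i +_)) (g ∘ (i +_)) m
slide-sound (suc k) m {f} {g} a b d zero    _ = differ-sound m a b (proj₁ (Equivalence.to T-∧ d))
slide-sound (suc k) m {f} {g} a b d (suc i) (s≤s i<k)
  with d′ ← proj₂ (Equivalence.to (T-∧ {differ m (applyUpTo f a) (applyUpTo g b)}) d)
  rewrite drop-applyUpTo f 1 a | drop-applyUpTo g 1 b = slide-sound k m (a ∸ 1) (b ∸ 1) d′ i i<k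

T-all-upTo : ∀ (f : ℕ → Bool) n → T (all f (upTo n)) → ∀ i → i < n → T (f i)
T-all-upTo f n h i i<n = All.lookup (all⁺ f (upTo n) h) (∈-upTo⁺ i<n)

xor-cancelˡ : ∀ a {x y} → a xor x ≡ a xor y → x ≡ y
xor-cancelˡ a {x} {y} eq = begin
  x               ≡⟨ cong (_xor x) (xor-same a) ⟨
  (a xor a) xor x ≡⟨ xor-assoc a a x ⟩
  a xor (a xor x) ≡⟨ cong (a xor_) eq ⟩
  a xor (a xor y) ≡⟨ xor-assoc a a y ⟨
  (a xor a) xor y ≡⟨ cong (_xor y) (xor-same a) ⟩
  y               ∎
  where open ≡-Reasoning

-- Uniform morphisms with complementary images and their fixed points

module Substitution (q : ℕ) .{{_ : NonZero q}} (c : ℕ → Bool) where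

  block : Bool → List Bool
  block b = applyUpTo (λ t → c t xor b) q

  substitute : List Bool → List Bool
  substitute = concatMap block

  _IsImageOf_ : (ℕ → Bool) → (ℕ → Bool) → Set
  f IsImageOf g = ∀ k t → t < q → f (k * q + t) ≡ c t xor g k

  -- Links the pointwise relation used in proofs to the lists on which the finite checks compute.
  applyUpTo-image : ∀ {f g} → f IsImageOf g → ∀ m → applyUpTo f (m * q) ≡ substitute (applyUpTo g m)
  applyUpTo-image           img zero    = refl
  applyUpTo-image {f} {g} img (suc m) = trans (applyUpTo-+ f q (m * q)) (cong₂ _++_
    (applyUpTo-cong q (img 0))
    (applyUpTo-image (λ k t t<q → trans (cong f (sym (+-assoc q (k * q) t))) (img (suc k) t t<q)) m))

  image-shift : ∀ {f g} → f IsImageOf g → ∀ k → (f ∘ (k * q +_)) IsImageOf (g ∘ (k +_))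
  image-shift {f} img k l t t<q = trans (cong f eq) (img (k + l) t t<q)
    where
    eq : k * q + (l * q + t) ≡ (k + l) * q + t
    eq = trans (sym (+-assoc (k * q) (l * q) t)) (cong (_+ t) (sym (*-distribʳ-+ q k l)))

module FixedPoint (q : ℕ) .{{_ : NonZero q}} (1<q : 1 < q) (c : ℕ → Bool) (c₀ : c 0 ≡ false) where

  open Substitution q c public

  -- The first argument is fuel: any bound on the number of base-q digits of the second.
  digitXor : ℕ → ℕ → Bool
  digitXor zero    n = false
  digitXor (suc f) n = c (n % q) xor digitXor f (n ℕ./ q)

  -- The xor of `c` over the base-`q` digits of `n`; for `q` = 2 and `c` the identity on digits this
  -- is the Thue-Morse word.
  word : ℕ → Bool
  word n = digitXor n n

  -- Leading zeros contribute nothing because `c 0` is `false`. Surplus fuel reads only such zeros,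
  -- whence `digitXor-fuel`.
  digitXor-0 : ∀ f → digitXor f 0 ≡ false
  digitXor-0 zero    = refl
  digitXor-0 (suc f) = cong₂ _xor_
    (trans (cong c (m<n⇒m%n≡m (<-trans z<s 1<q))) c₀)
    (trans (cong (digitXor f) (0/n≡0 q)) (digitXor-0 f))

  n/q≤f : ∀ {n f} → n ≤ suc f → n ℕ./ q ≤ f
  n/q≤f {zero}  _   = ≤-trans (≤-reflexive (0/n≡0 q)) z≤n
  n/q≤f {suc n} n<f = m<1+n⇒m≤n (<-≤-trans (m/n<m (suc n) q 1<q) n<f)

  digitXor-fuel : ∀ f g {n} → n ≤ f → n ≤ g → digitXor f n ≡ digitXor g n
  digitXor-fuel zero    g       z≤n _   = sym (digitXor-0 g)
  digitXor-fuel (suc f) zero    _   z≤n = digitXor-0 (suc f)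
  digitXor-fuel (suc f) (suc g) {n} n≤f n≤g = cong (c (n % q) xor_) (digitXor-fuel f g (n/q≤f n≤f) (n/q≤f n≤g))

  word-step : ∀ n → word n ≡ c (n % q) xor word (n ℕ./ q)
  word-step n = trans (digitXor-fuel n (suc n) ≤-refl (n≤1+n n))
    (cong (c (n % q) xor_) (digitXor-fuel n (n ℕ./ q) (n/q≤f (n≤1+n n)) ≤-refl))

  word-image : word IsImageOf word
  word-image k t t<q = trans (word-step (k * q + t)) (cong₂ (λ a b → c a xor word b) mod div)
    where
    mod : (k * q + t) % q ≡ t
    mod = trans (cong (_% q) (+-comm (k * q) t)) (trans ([m+kn]%n≡m%n t k q) (m<n⇒m%n≡m t<q))
    div : (k * q + t) ℕ./ q ≡ k
    div = begin
      (k * q + t) ℕ./ q     ≡⟨ cong (ℕ._/ q) (+-comm (k * q) t) ⟩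
      (t + k * q) ℕ./ q     ≡⟨ +-distrib-/-∣ʳ t (divides-refl k) ⟩
      t ℕ./ q + k * q ℕ./ q   ≡⟨ cong₂ _+_ (m<n⇒m/n≡0 t<q) (m*n/n≡m k q) ⟩
      k                   ∎
      where open ≡-Reasoning

  -- Periods under the morphism

  HasPeriod : ℕ → ℕ → ℕ → Set
  HasPeriod p i m = Agree (word ∘ (i +_)) (word ∘ ((i + p) +_)) m

  -- A shift by `d * q` keeps the offset inside a block and moves the block index by `d`.
  periodic-lift : ∀ {d k m} → HasPeriod d k m → HasPeriod (d * q) (k * q) (m * q)
  periodic-lift {d} {k} {m} per t t<mq = begin
    word (k * q + t)                       ≡⟨ unfold k ⟩
    c (t % q) xor word (k + t ℕ./ q)       ≡⟨ cong (c (t % q) xor_) (per (t ℕ./ q) (m<n*o⇒m/o<n t<mq)) ⟩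
    c (t % q) xor word (k + d + t ℕ./ q)   ≡⟨ unfold (k + d) ⟨
    word ((k + d) * q + t)                 ≡⟨ cong (λ l → word (l + t)) (*-distribʳ-+ q k d) ⟩
    word (k * q + d * q + t)               ∎
    where
    open ≡-Reasoning
    unfold : ∀ l → word (l * q + t) ≡ c (t % q) xor word (l + t ℕ./ q)
    unfold l = trans (cong (λ u → word (l * q + u)) (trans (m≡m%n+[m/n]*n t q) (+-comm (t % q) _)))
      (image-shift {word} {word} word-image l (t ℕ./ q) (t % q) (m%n<n t q))

  -- The letters sampled at offset `i % q` all carry the same mask `c r`; cancelling it recovers the
  -- letters of the preimage.
  periodic-descend : ∀ {d i m n} → HasPeriod (d * q) i m → (∀ {t} → t < n → t * q < m) → HasPeriod d (i ℕ./ q) n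
  periodic-descend {d} {i} {m} {n} per tq<m t t<n = xor-cancelˡ (c r) (begin
    c r xor word (k + t)         ≡⟨ word-image (k + t) r (m%n<n i q) ⟨
    word ((k + t) * q + r)       ≡⟨ cong word (shape k r t q) ⟩
    word (r + k * q + t * q)     ≡⟨ cong (λ u → word (u + t * q)) (m≡m%n+[m/n]*n i q) ⟨
    word (i + t * q)             ≡⟨ per (t * q) (tq<m t<n) ⟩
    word (i + d * q + t * q)     ≡⟨ cong (λ u → word (u + d * q + t * q)) (m≡m%n+[m/n]*n i q) ⟩
    word (r + k * q + d * q + t * q) ≡⟨ cong word (shape′ k r t d q) ⟨
    word ((k + d + t) * q + r)   ≡⟨ word-image (k + d + t) r (m%n<n i q) ⟩
    c r xor word (k + d + t)     ∎)
    where
    open ≡-Reasoning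
    r = i % q
    k = i ℕ./ q
    shape : ∀ k r t q → (k + t) * q + r ≡ r + k * q + t * q
    shape = solve-∀
    shape′ : ∀ k r t d q → (k + d + t) * q + r ≡ r + k * q + d * q + t * q
    shape′ = solve-∀

  applyUpTo-word : ∀ k m → applyUpTo (word ∘ (k * q +_)) (m * q) ≡ substitute (applyUpTo (word ∘ (k +_)) m)
  applyUpTo-word k m = applyUpTo-image (image-shift {word} {word} word-image k) m

  -- Finite checks on images of short words

  -- Two consecutive blocks contain the window of length `q` at every inner offset. The offset is
  -- `suc r` because at offset 0 a block may well match.
  syncCheck : Bool → Bool → Bool → ℕ → Bool
  syncCheck a b b′ r = differ q (substitute (a ∷ [])) (drop (suc r) (substitute (b ∷ b′ ∷ [])))

  syncCheck-sound : ∀ j k r → T (syncCheck (word (j + 0)) (word (k + 0)) (word (k + 1)) r) →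
                    Differ (λ t → word (j * q + t)) (λ t → word (k * q + (suc r + t))) q
  syncCheck-sound j k r d = differ-drop q (suc r) (1 * q) (2 * q)
    (subst₂ (λ xs ys → T (differ q xs (drop (suc r) ys))) (sym (applyUpTo-word j 1)) (sym (applyUpTo-word k 2)) d)

  -- For the period `suc p`, `suc (4 * suc p / 3)` is the least `m` with `4 * suc p < 3 * m`. With
  -- `q` = 39 and period 58 a start needs 136 letters, more than the 78 of two blocks; hence second
  -- iterates.
  smallCheck : List Bool → ℕ → Bool
  smallCheck xs p = slide (q * q) (suc (4 * suc p ℕ./ 3)) xs (drop (suc p) xs)

  smallCheck-sound : ∀ k p → T (smallCheck (substitute (substitute (word (k + 0) ∷ word (k + 1) ∷ []))) p) → ∀ i → i < q * q →
                     Differ (λ t → word (k * q * q + (i + t))) (λ t → word (k * q * q + (suc p + (i + t)))) (suc (4 * suc p ℕ./ 3))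
  smallCheck-sound k p d = slide-sound (q * q) _ {f} n (n ∸ suc p)
    (subst (λ ys → T (slide (q * q) _ (applyUpTo f n) ys)) (drop-applyUpTo f (suc p) n)
      (subst (λ xs → T (smallCheck xs p)) (sym (trans (applyUpTo-word (k * q) (2 * q)) (cong substitute (applyUpTo-word k 2)))) d))
    where
    f = λ t → word (k * q * q + t)
    n = 2 * q * q

  -- Power-freeness by descent on the period

  module Freeness
    (sync-checked : ∀ a b b′ → T (all (syncCheck a b b′) (upTo (q ∸ 1))))
    -- Ensures that `s < p` and `4 * p < 3 * m` give `2 * q < m`, enough room for `unsynchronised`.
    (s : ℕ) (3q≤2s+2 : 3 * q ≤ 2 * suc s)
    (small-checked : ∀ a b → T (all (smallCheck (substitute (substitute (a ∷ b ∷ [])))) (upTo s)))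
    where

    instance
      q*q≢0 : NonZero (q * q)
      q*q≢0 = m*n≢0 q q

    sync : ∀ j k r → 0 < r → r < q → Differ (λ t → word (j * q + t)) (λ t → word (k * q + (r + t))) q
    sync j k (suc r) _ r<q = syncCheck-sound j k r
      (T-all-upTo _ _ (sync-checked _ _ _) r (∸-monoˡ-< r<q (s≤s z≤n)))

    -- Every `i` lies in the first of two consecutive blocks of length `q * q`, so the finite check
    -- reaches all positions.
    small : ∀ p → 0 < p → p ≤ s → ∀ i → Differ (λ t → word (i + t)) (λ t → word (i + p + t)) (suc (4 * p ℕ./ 3))
    small (suc p) _ p<s i
      with t , t< , ne ← smallCheck-sound (i ℕ./ (q * q)) p (T-all-upTo _ s (small-checked _ _) p p<s)
                           (i % (q * q)) (m%n<n i (q * q))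
      = t , t< , λ eq → ne (trans (cong word left) (trans eq (cong word right)))
      where
      r = i % (q * q)
      k = i ℕ./ (q * q)
      i≡ : k * q * q + r ≡ i
      i≡ = trans (cong (_+ r) (*-assoc k q q)) (trans (+-comm _ r) (sym (m≡m%n+[m/n]*n i (q * q))))
      left : k * q * q + (r + t) ≡ i + t
      left = trans (sym (+-assoc _ r t)) (cong (_+ t) i≡)
      right : i + suc p + t ≡ k * q * q + (suc p + (r + t))
      right = trans (cong (λ u → u + suc p + t) (sym i≡)) (shape (k * q * q) r (suc p) t)
        where
        shape : ∀ a r p t → a + r + p + t ≡ a + (p + (r + t))
        shape = solve-∀

    unsynchronised : ∀ {p i m} → 0 < p % q → 2 * q ≤ m → ¬ HasPeriod p i m
    unsynchronised {p} {i} {m} 0<r 2q≤m per with sync j (j + p ℕ./ q) (p % q) 0<r (m%n<n p q)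
      where j = suc (i ℕ./ q)
    ... | t , t<q , ne = ne (begin
      word (suc k * q + t)                     ≡⟨ cong (λ u → word (u + t)) i+e ⟨
      word (i + e + t)                         ≡⟨ cong word (+-assoc i e t) ⟩
      word (i + (e + t))                       ≡⟨ per (e + t) e+t<m ⟩
      word (i + p + (e + t))                   ≡⟨ cong word (shape i p e t) ⟩
      word (i + e + (p + t))                   ≡⟨ cong₂ (λ u v → word (u + (v + t))) i+e (m≡m%n+[m/n]*n p q) ⟩
      word (suc k * q + (p % q + p ℕ./ q * q + t)) ≡⟨ cong word (shape′ (suc k) q (p % q) (p ℕ./ q) t) ⟩
      word ((suc k + p ℕ./ q) * q + (p % q + t))   ∎)
      where
      open ≡-Reasoning
      k = i ℕ./ q
      -- Distance to the first block boundary strictly after `i`, equal to `q` if `i` is itself a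
      -- boundary. The block starting there ends within `2 * q` letters of `i`.
      e = q ∸ i % q
      i+e : i + e ≡ suc k * q
      i+e = begin
        i + e                     ≡⟨ cong (_+ e) (m≡m%n+[m/n]*n i q) ⟩
        i % q + k * q + e         ≡⟨ shape₀ (i % q) (k * q) e ⟩
        i % q + e + k * q         ≡⟨ cong (_+ k * q) (m+[n∸m]≡n (<⇒≤ (m%n<n i q))) ⟩
        q + k * q                 ∎
        where
        shape₀ : ∀ a b c → a + b + c ≡ a + c + b
        shape₀ = solve-∀
      e+t<m : e + t < m
      e+t<m = <-≤-trans (+-mono-≤-< (m∸n≤m q (i % q)) t<q) (≤-trans (≤-reflexive (cong (_+_ q) (sym (+-identityʳ q)))) 2q≤m)
      shape : ∀ i p e t → i + p + (e + t) ≡ i + e + (p + t)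
      shape = solve-∀
      shape′ : ∀ k q r d t → k * q + (r + d * q + t) ≡ (k + d) * q + (r + t)
      shape′ = solve-∀

    free : ∀ p → 0 < p → ∀ i m → 4 * p < 3 * m → ¬ HasPeriod p i m
    free = <-rec (λ p → 0 < p → ∀ i m → 4 * p < 3 * m → ¬ HasPeriod p i m) step
      where
      step : ∀ p → (∀ {d} → d < p → 0 < d → ∀ i m → 4 * d < 3 * m → ¬ HasPeriod d i m) →
             0 < p → ∀ i m → 4 * p < 3 * m → ¬ HasPeriod p i m
      step p rec 0<p i m long per with p ≤? s
      -- The difference lies before `suc (4 * p / 3)`, which is at most `m` by `long`.
      ... | yes p≤s = let t , t< , ne = small p 0<p p≤s i in
                      ne (per t (<-≤-trans t< (m<n*o⇒m/o<n {n = m} (subst (_<_ (4 * p)) (*-comm 3 m) long))))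
      ... | no  p≰s with p % q in r
      ...   | suc _ = unsynchronised {i = i} (subst (_<_ 0) (sym r) z<s) (<⇒≤ (*-cancelˡ-< 3 (2 * q) m (begin-strict
                        3 * (2 * q)  ≡⟨ *-assoc 3 2 q ⟨
                        6 * q        ≡⟨ *-assoc 2 3 q ⟩
                        2 * (3 * q)  ≤⟨ *-monoʳ-≤ 2 3q≤2s+2 ⟩
                        2 * (2 * suc s)  ≡⟨ *-assoc 2 2 (suc s) ⟨
                        4 * suc s    ≤⟨ *-monoʳ-≤ 4 (≰⇒> p≰s) ⟩
                        4 * p        <⟨ long ⟩
                        3 * m        ∎))) per
        where open ≤-Reasoning
      -- `suc (m-1 / q)` is `m / q` rounded up, the number of multiples of `q` below `m`. Rounding
      -- up is what preserves the strict inequality for `d`.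
      ...   | zero = rec {d} d<p 0<d (i ℕ./ q) (suc (m-1 ℕ./ q)) long′
                       (periodic-descend {i = i} (subst (λ u → HasPeriod u i m) p≡dq per) tq<m)
        where
        d = p ℕ./ q
        m-1 = m ∸ 1
        p≡dq : p ≡ d * q
        p≡dq = trans (m≡m%n+[m/n]*n p q) (cong (_+ d * q) r)
        d<p : d < p
        d<p = m/n<m p q {{>-nonZero 0<p}} 1<q
        0<d : 0 < d
        0<d = n≢0⇒n>0 λ d≡0 → <⇒≢ 0<p (sym (trans p≡dq (cong (_* q) d≡0)))
        1≤m : 1 ≤ m
        1≤m = *-cancelˡ-< 3 0 m (≤-<-trans z≤n long)
        tq<m : ∀ {t} → t < suc (m-1 ℕ./ q) → t * q < m
        tq<m {t} t< = begin-strict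
          t * q                              ≤⟨ *-monoˡ-≤ q (m<1+n⇒m≤n t<) ⟩
          m-1 ℕ./ q * q                      ≤⟨ m/n*n≤m m-1 q ⟩
          m-1                                <⟨ n<1+n m-1 ⟩
          suc m-1                            ≡⟨ m+[n∸m]≡n 1≤m ⟩
          m                                  ∎
          where open ≤-Reasoning
        m≤ : m ≤ suc (m-1 ℕ./ q) * q
        m≤ = begin
          m                                  ≡⟨ m+[n∸m]≡n 1≤m ⟨
          suc m-1                            ≡⟨ cong suc (m≡m%n+[m/n]*n m-1 q) ⟩
          suc (m-1 % q) + m-1 ℕ./ q * q      ≤⟨ +-monoˡ-≤ _ (m%n<n m-1 q) ⟩
          q + m-1 ℕ./ q * q                  ∎
          where open ≤-Reasoning
        long′ : 4 * d < 3 * suc (m-1 ℕ./ q)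
        long′ = *-cancelʳ-< q (4 * d) (3 * suc (m-1 ℕ./ q)) (begin-strict
          4 * d * q                          ≡⟨ *-assoc 4 d q ⟩
          4 * (d * q)                        ≡⟨ cong (_*_ 4) p≡dq ⟨
          4 * p                              <⟨ long ⟩
          3 * m                              ≤⟨ *-monoʳ-≤ 3 m≤ ⟩
          3 * (suc (m-1 ℕ./ q) * q)          ≡⟨ *-assoc 3 (suc (m-1 ℕ./ q)) q ⟨
          3 * suc (m-1 ℕ./ q) * q            ∎)
          where open ≤-Reasoning

-- The 39-uniform morphism

-- Found by computer search among the images of 0 that begin with an overlap.
digits : List ℕ
digits =
  0 ∷ 1 ∷ 1 ∷ 0 ∷ 1 ∷ 0 ∷ 0 ∷ 1 ∷ 1 ∷ 0 ∷ 1 ∷ 1 ∷ 0 ∷ 0 ∷ 1 ∷ 0 ∷ 1 ∷ 1 ∷ 0 ∷ 1 ∷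
  0 ∷ 0 ∷ 1 ∷ 1 ∷ 0 ∷ 1 ∷ 1 ∷ 0 ∷ 0 ∷ 1 ∷ 0 ∷ 0 ∷ 1 ∷ 1 ∷ 0 ∷ 1 ∷ 0 ∷ 0 ∷ 1 ∷ []

nth : List ℕ → ℕ → Bool
nth []           _       = false
nth (b ∷ bs) zero    = b ≡ᵇ 1
nth (b ∷ bs) (suc t) = nth bs t

open FixedPoint 39 (toWitness {a? = 1 <? 39} _) (nth digits) refl

-- Once the letters are split, each check is a closed Boolean evaluating to `true`. The range
-- `upTo 38` stands for the offsets 1 to 38.
sync-checked : ∀ a b b′ → T (all (syncCheck a b b′) (upTo 38))
sync-checked false false false = _
sync-checked false false true  = _
sync-checked false true  false = _
sync-checked false true  true  = _
sync-checked true  false false = _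
sync-checked true  false true  = _
sync-checked true  true  false = _
sync-checked true  true  true  = _

small-checked : ∀ a b → T (all (smallCheck (substitute (substitute (a ∷ b ∷ [])))) (upTo 58))
small-checked false false = _
small-checked false true  = _
small-checked true  false = _
small-checked true  true  = _

-- 58 is the least s with 3 · 39 ≤ 2 (s + 1).
open Freeness sync-checked 58 (toWitness {a? = 117 ≤? 118} _) small-checked

-- Agreement on 16 letters at distance 15 is one more than a square requires; iteration turns this
-- surplus into a slack of `39 ^ n` for the start of the square.
prefix-run : ∀ n → HasPeriod (15 * 39 ^ n) 0 (16 * 39 ^ n)
prefix-run zero    = λ t t<16 → toWitness {a? = allUpTo? (λ t → word t ≟ word (15 + t)) 16} _ t<16
prefix-run (suc n) = subst₂ (λ p m → HasPeriod p 0 m) (shift 15) (shift 16) (periodic-lift {15 * 39 ^ n} {0} (prefix-run n))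
  where
  shift : ∀ a → a * 39 ^ n * 39 ≡ a * 39 ^ suc n
  shift a = trans (*-assoc a (39 ^ n) 39) (cong (_*_ a) (*-comm (39 ^ n) 39))

n<39^n : ∀ n → n < 39 ^ n
n<39^n zero    = z<s
n<39^n (suc n) = ≤-<-trans (n<39^n n) (^-monoʳ-< 39 (toWitness {a? = 1 <? 39} _) (n<1+n n))

-- Transfer to the alphabet `Fin 2`

bit : Bool → Fin 2
bit false = zero
bit true  = suc zero

bit-injective : ∀ {a b} → bit a ≡ bit b → a ≡ b
bit-injective {false} {false} _ = refl
bit-injective {true}  {true}  _ = refl

bits-power⁺-free : Power⁺-Free ((ℤ.+ 7) ℚ./ 3) (bit ∘ word)
bits-power⁺-free u (i , occurs) pow with power⁺-period pow
... | xs , 0<p , 7p<3l , pre = free p 0<p i (l ∸ p) 4p<3m per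
  where
  open ≤-Reasoning
  p = length xs
  l = length u
  -- A length `l` with period `p` allows `l ∸ p` comparisons, so `3 * p` is subtracted from both
  -- sides of `7 * p < 3 * l`.
  4p<3m : 4 * p < 3 * (l ∸ p)
  4p<3m = +-cancelʳ-< (3 * p) (4 * p) (3 * (l ∸ p)) (begin-strict
    4 * p + 3 * p           ≡⟨ *-distribʳ-+ p 4 3 ⟨
    7 * p                   <⟨ 7p<3l ⟩
    3 * l                   ≤⟨ *-monoʳ-≤ 3 (m≤n+m∸n l p) ⟩
    3 * (p + (l ∸ p))       ≡⟨ *-distribˡ-+ 3 p (l ∸ p) ⟩
    3 * p + 3 * (l ∸ p)     ≡⟨ +-comm (3 * p) _ ⟩
    3 * (l ∸ p) + 3 * p     ∎)
  per : HasPeriod p i (l ∸ p)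
  per t t<m = bit-injective (sym (trans (cong (λ k → bit (word k)) (+-assoc i p t))
    (prefix-shift xs (λ k → bit (word (i + k))) (λ k → bit (word (i + k))) l l
      (subst (λ v → Prefix _≡_ v (xs ++ v)) (sym occurs) pre) t
      (≰⇒> λ l≤p+t → <⇒≱ t<m (m≤n+o⇒m∸n≤o l p l≤p+t)))))

bits-squares : ∀ i N → ∃[ u ] (IsSquare u × N ≤ length u × OccursAt (bit ∘ word) i u)
bits-squares i N with square-at (bit ∘ word) i (15 * Q) 0<15Q per
  where
  -- The exponent `i + N` makes `Q` exceed both `i`, so that a square may start there, and `N`, so
  -- that it is long enough.
  Q = 39 ^ (i + N)
  0<15Q : 0 < 15 * Q
  0<15Q = ≤-trans (m^n>0 39 (i + N)) (m≤n*m Q 15)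
  per : Agree (λ t → bit (word (i + t))) (λ t → bit (word (i + (15 * Q + t)))) (15 * Q)
  per t t<P = cong bit (trans
    -- `16 * Q` unfolds to `Q + 15 * Q`, so the bounds on `i` and `t` simply add up.
    (prefix-run (i + N) (i + t) (+-mono-<-≤ (≤-<-trans (m≤m+n i N) (n<39^n (i + N))) (<⇒≤ t<P)))
    (cong word (shape (15 * Q) i t)))
    where
    shape : ∀ p i t → p + (i + t) ≡ i + (p + t)
    shape = solve-∀
... | u , square , len , occurs = u , square , N≤ , occurs
  where
  Q = 39 ^ (i + N)
  N≤ : N ≤ length u
  N≤ = begin
    N                 ≤⟨ m≤n+m N i ⟩
    i + N             ≤⟨ <⇒≤ (n<39^n (i + N)) ⟩
    Q                 ≤⟨ m≤n*m Q 15 ⟩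
    15 * Q            ≤⟨ m≤m+n _ _ ⟩
    15 * Q + 15 * Q   ≡⟨ len ⟨
    length u          ∎
    where open ≤-Reasoning

open import Data.Integer.Base using (+_)
open import Data.Rational.Base using (_/_)

theorem4 : Σ[ w ∈ InfiniteWord (Fin 2) ]
    ( Power⁺-Free (+ 7 / 3) w
    × (∀ (i N : ℕ) → ∃[ u ] (IsSquare u × N ≤ length u × OccursAt w i u)) )
theorem4 = bit ∘ word , bits-power⁺-free , bits-squares
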